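{- For the integral covering graph $D(1,1)$ of the vector $(1,1)$ we have $\mathrm{box}(D(1,1))=\dim_{TH}(D(1,1))=0$. For every integer $m\ge 1$, the integral covering graph $D(m)$ of the one-entry vector $(m)$ satisfies \[\mathrm{box}(D(m))=\dim_{TH}(D(m))=\begin{cases}0 & \text{if } m\le 3,\\ 1 & \text{if } m\ge 4.\end{cases}\]
   Context: $[m]_0=\{0,1,\dots,m\}$. For $\bm{m}=(m_1,\dots,m_n)\in\mathbb{Z}_{\ge 1}^n$, the integral covering graph $D(\bm{m})$ has vertex set $\prod_{i=1}^n [m_i]_0\setminus\{\bm{0},\bm{m}\}$, where $\bm 0$ is the all-zero vector, and two distinct vertices $\bm v,\bm w$ are adjacent iff $v_i+w_i\ge m_i$ for all $i$. The boxicity $\mathrm{box}(G)$ of a finite simple graph $G$ is the minimum integer $d\ge 0$ such that there exist $d$ interval graphs $I_1,\dots,I_d$ on $V(G)$ with $E(G)=\bigcap_{j=1}^d E(I_j)$. For a finite set $V$, $\alpha\colon V\to\mathbb{R}$ and $S\in\mathbb{R}$, the threshold graph $T(\alpha,S)$ has vertex set $V$ and edges all $\{v,w\}$, $v\neq w$, with $\alpha(v)+\alpha(w)\ge S$; a graph is a threshold graph if it is of this form. The threshold dimension $\dim_{TH}(G)$ is the minimum $d\ge 0$ such that there exist $d$ threshold graphs $H_1,\dots,H_d$ on $V(G)$ with $E(G)=\bigcap_{j=1}^d E(H_j)$. In both definitions the empty intersection ($d=0$) is the set of all pairs of vertices, so the parameter is $0$ exactly for complete graphs (including the graph with no vertices).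 -}

module Defs where

open import Data.Empty.Irrelevant renaming (⊥-elim to ⊥-elim-irr)
open import Data.Fin.Base using (Fin)
open import Data.List.Base using (List; []; [_]; concatMap; cartesianProductWith; upTo)
open import Data.List.Membership.Propositional using (_∈_; lose)
open import Data.List.Membership.Propositional.Properties
  using (∈-concatMap⁺; ∈-cartesianProductWith⁺; ∈-upTo⁺)
open import Data.List.Relation.Unary.Any using (here)
open import Data.Nat.Base as ℕ using (ℕ; suc)
import Data.Nat.Properties as ℕₚ
open import Data.Product.Base using (Σ; ∃-syntax; _×_; _,_; proj₁; proj₂)
open import Data.Rational.Base as ℚ using (ℚ; 0ℚ; ½)
import Data.Rational.Properties as ℚₚ
open import Data.Vec.Base as Vec using (Vec; lookup; replicate)
open import Data.Vec.Properties using (≡-dec)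
open import Data.Vec.Relation.Binary.Pointwise.Inductive as Pointwise using (Pointwise)
open import Function.Base using (_∘_)
open import Function.Bundles using (_⇔_)
open import Relation.Binary.Core using (Rel)
open import Relation.Binary.Definitions using (Symmetric; Irreflexive)
open import Relation.Binary.PropositionalEquality
  using (_≡_; _≢_; refl; sym; trans; cong; subst; module ≡-Reasoning)
open import Relation.Nullary.Decidable using (Dec; yes; no; _×-dec_; ¬?; recompute)
open import Level using (0ℓ)

-- Real numbers: Cauchy sequences of rationals.  Two sequences denote the same
-- real when x ≤ʳ y and y ≤ʳ x.

IsCauchy : (ℕ → ℚ) → Set
IsCauchy x = ∀ ε → 0ℚ ℚ.< ε →
  ∃[ N ] ∀ i j → N ℕ.≤ i → N ℕ.≤ j → ℚ.∣ x i ℚ.- x j ∣ ℚ.< ε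

record ℝ : Set where
  constructor mkℝ
  field
    seq    : ℕ → ℚ
    cauchy : IsCauchy seq

open ℝ public

infix 4 _≤ʳ_
_≤ʳ_ : Rel ℝ 0ℓ
x ≤ʳ y = ∀ ε → 0ℚ ℚ.< ε → ∃[ N ] ∀ i → N ℕ.≤ i → seq x i ℚ.≤ seq y i ℚ.+ ε

private
  half+half : ∀ ε → ½ ℚ.* ε ℚ.+ ½ ℚ.* ε ≡ ε
  half+half ε = trans (sym (ℚₚ.*-distribʳ-+ ε ½ ½)) (ℚₚ.*-identityˡ ε)

  half-pos : ∀ ε → 0ℚ ℚ.< ε → 0ℚ ℚ.< ½ ℚ.* ε
  half-pos ε 0<ε = subst (ℚ._< ½ ℚ.* ε) (ℚₚ.*-zeroʳ ½) (ℚₚ.*-monoʳ-<-pos ½ 0<ε)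

  interchange : ∀ a b c d → (a ℚ.+ b) ℚ.- (c ℚ.+ d) ≡ (a ℚ.- c) ℚ.+ (b ℚ.- d)
  interchange a b c d = begin
    (a ℚ.+ b) ℚ.- (c ℚ.+ d)             ≡⟨ cong ((a ℚ.+ b) ℚ.+_) (ℚₚ.neg-distrib-+ c d) ⟩
    (a ℚ.+ b) ℚ.+ (ℚ.- c ℚ.+ ℚ.- d)     ≡⟨ ℚₚ.+-assoc a b _ ⟩
    a ℚ.+ (b ℚ.+ (ℚ.- c ℚ.+ ℚ.- d))     ≡⟨ cong (a ℚ.+_) (ℚₚ.+-assoc b (ℚ.- c) (ℚ.- d)) ⟨
    a ℚ.+ ((b ℚ.+ ℚ.- c) ℚ.+ ℚ.- d)     ≡⟨ cong (λ z → a ℚ.+ (z ℚ.+ ℚ.- d)) (ℚₚ.+-comm b (ℚ.- c)) ⟩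
    a ℚ.+ ((ℚ.- c ℚ.+ b) ℚ.+ ℚ.- d)     ≡⟨ cong (a ℚ.+_) (ℚₚ.+-assoc (ℚ.- c) b (ℚ.- d)) ⟩
    a ℚ.+ (ℚ.- c ℚ.+ (b ℚ.+ ℚ.- d))     ≡⟨ ℚₚ.+-assoc a (ℚ.- c) _ ⟨
    (a ℚ.- c) ℚ.+ (b ℚ.- d)             ∎
    where open ≡-Reasoning

infixl 6 _+ʳ_
_+ʳ_ : ℝ → ℝ → ℝ
seq    (x +ʳ y) i = seq x i ℚ.+ seq y i
cauchy (x +ʳ y) ε 0<ε = N ℕ.⊔ M , λ i j ≤i ≤j → begin-strict
    ℚ.∣ (seq x i ℚ.+ seq y i) ℚ.- (seq x j ℚ.+ seq y j) ∣
      ≡⟨ cong ℚ.∣_∣ (interchange (seq x i) (seq y i) (seq x j) (seq y j)) ⟩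
    ℚ.∣ (seq x i ℚ.- seq x j) ℚ.+ (seq y i ℚ.- seq y j) ∣
      ≤⟨ ℚₚ.∣p+q∣≤∣p∣+∣q∣ (seq x i ℚ.- seq x j) (seq y i ℚ.- seq y j) ⟩
    ℚ.∣ seq x i ℚ.- seq x j ∣ ℚ.+ ℚ.∣ seq y i ℚ.- seq y j ∣
      <⟨ ℚₚ.+-mono-< (proj₂ cx i j (ℕₚ.m⊔n≤o⇒m≤o N M ≤i) (ℕₚ.m⊔n≤o⇒m≤o N M ≤j))
                     (proj₂ cy i j (ℕₚ.m⊔n≤o⇒n≤o N M ≤i) (ℕₚ.m⊔n≤o⇒n≤o N M ≤j)) ⟩
    ½ ℚ.* ε ℚ.+ ½ ℚ.* ε
      ≡⟨ half+half ε ⟩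
    ε ∎
  where
  open ℚₚ.≤-Reasoning
  cx = cauchy x (½ ℚ.* ε) (half-pos ε 0<ε)
  cy = cauchy y (½ ℚ.* ε) (half-pos ε 0<ε)
  N  = proj₁ cx
  M  = proj₁ cy

record SimpleGraph (V : Set) : Set₁ where
  field
    Adj        : Rel V 0ℓ
    adj-sym    : Symmetric Adj
    adj-irrefl : Irreflexive _≡_ Adj

open SimpleGraph public using (Adj)

record FiniteSimpleGraph : Set₁ where
  field
    Vertex     : Set
    vertices   : List Vertex
    enumerates : ∀ v → v ∈ vertices
    graph      : SimpleGraph Vertex

open FiniteSimpleGraph public using (Vertex; graph)

record ClosedInterval : Set where
  field
    left right : ℝ
    left≤right : left ≤ʳ right

open ClosedInterval public

infix 4 _∈ᴵ_
_∈ᴵ_ : ℝ → ClosedInterval → Set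
x ∈ᴵ I = left I ≤ʳ x × x ≤ʳ right I

Intersects : Rel ClosedInterval 0ℓ
Intersects I J = ∃[ x ] x ∈ᴵ I × x ∈ᴵ J

IsIntervalGraph : ∀ {V} → SimpleGraph V → Set
IsIntervalGraph {V} H = Σ (V → ClosedInterval) λ I →
  ∀ v w → Adj H v w ⇔ (v ≢ w × Intersects (I v) (I w))

thresholdGraph : ∀ {V} → (V → ℝ) → ℝ → SimpleGraph V
thresholdGraph α S = record
  { Adj        = λ v w → v ≢ w × S ≤ʳ α v +ʳ α w
  ; adj-sym    = λ {v} {w} (v≢w , p) → v≢w ∘ sym , λ ε 0<ε →
      proj₁ (p ε 0<ε) , λ i N≤i →
        subst (λ z → seq S i ℚ.≤ z ℚ.+ ε) (ℚₚ.+-comm (seq (α v) i) (seq (α w) i))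
              (proj₂ (p ε 0<ε) i N≤i)
  ; adj-irrefl = λ v≡w (v≢w , _) → v≢w v≡w
  }

IsThresholdGraph : ∀ {V} → SimpleGraph V → Set
IsThresholdGraph {V} H = Σ (V → ℝ) λ α → Σ ℝ λ S →
  ∀ v w → Adj H v w ⇔ Adj (thresholdGraph α S) v w

-- The edges of G are the pairs of distinct vertices that are edges of all of
-- d graphs from the class P on V(G); for d = 0 this says that G is complete.
IsIntersectionOf : (∀ {V} → SimpleGraph V → Set) → FiniteSimpleGraph → ℕ → Set₁
IsIntersectionOf P G d = Σ (Fin d → SimpleGraph (Vertex G)) λ H →
  (∀ j → P (H j)) ×
  (∀ v w → v ≢ w → Adj (graph G) v w ⇔ (∀ j → Adj (H j) v w))

IsMinimum : (ℕ → Set₁) → ℕ → Set₁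
IsMinimum P d = P d × (∀ k → P k → d ℕ.≤ k)

-- "G has boxicity d" and "G has threshold dimension d".
Boxicity ThresholdDimension : FiniteSimpleGraph → ℕ → Set₁
Boxicity           G = IsMinimum (IsIntersectionOf IsIntervalGraph G)
ThresholdDimension G = IsMinimum (IsIntersectionOf IsThresholdGraph G)

-- The proofs are irrelevant so that equality of vertices is equality of vectors.
record CoverVertex {n} (m : Vec ℕ n) : Set where
  constructor mkVertex
  field
    coords    : Vec ℕ n
    .bounded  : Pointwise ℕ._≤_ coords m
    .nonzero  : coords ≢ replicate n 0
    .nonfull  : coords ≢ m

open CoverVertex public using (coords)

private
  box : ∀ {n} → Vec ℕ n → List (Vec ℕ n)
  box Vec.[]      = [ Vec.[] ]
  box (k Vec.∷ m) = cartesianProductWith Vec._∷_ (upTo (suc k)) (box m)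

  ∈-box : ∀ {n} {v m : Vec ℕ n} → Pointwise ℕ._≤_ v m → v ∈ box m
  ∈-box Pointwise.[]        = here refl
  ∈-box (v≤k Pointwise.∷ p) =
    ∈-cartesianProductWith⁺ Vec._∷_ (∈-upTo⁺ (ℕ.s≤s v≤k)) (∈-box p)

  module _ {n} (m : Vec ℕ n) where

    IsVertex : Vec ℕ n → Set
    IsVertex v = Pointwise ℕ._≤_ v m × v ≢ replicate n 0 × v ≢ m

    isVertex? : ∀ v → Dec (IsVertex v)
    isVertex? v = Pointwise.decidable ℕₚ._≤?_ v m
      ×-dec ¬? (≡-dec ℕₚ._≟_ v (replicate n 0)) ×-dec ¬? (≡-dec ℕₚ._≟_ v m)

    toVertex : ∀ {v} → Dec (IsVertex v) → List (CoverVertex m)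
    toVertex {v} (yes (b , z , f)) = [ mkVertex v b z f ]
    toVertex     (no _)            = []

    ∈-toVertex : ∀ (x : CoverVertex m) (d : Dec (IsVertex (coords x))) → x ∈ toVertex d
    ∈-toVertex x                  (yes _) = here refl
    ∈-toVertex (mkVertex v b z f) (no ¬p) =
      ⊥-elim-irr (¬p (b , z , f))

    coverVertices : List (CoverVertex m)
    coverVertices = concatMap (toVertex ∘ isVertex?) (box m)

    ∈-coverVertices : ∀ x → x ∈ coverVertices
    ∈-coverVertices x = ∈-concatMap⁺ (toVertex ∘ isVertex?)
      (lose (∈-box (recompute-bounded x)) (∈-toVertex x (isVertex? (coords x))))
      where
      recompute-bounded : (x : CoverVertex m) → Pointwise ℕ._≤_ (coords x) m
      recompute-bounded (mkVertex v b _ _) = recompute (Pointwise.decidable ℕₚ._≤?_ v m) b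

-- The integral covering graph, meant for vectors m with all entries positive.
D : ∀ {n} → Vec ℕ n → FiniteSimpleGraph
D m = record
  { Vertex     = CoverVertex m
  ; vertices   = coverVertices m
  ; enumerates = ∈-coverVertices m
  ; graph      = record
    { Adj        = λ v w → v ≢ w ×
                 (∀ i → lookup m i ℕ.≤ lookup (coords v) i ℕ.+ lookup (coords w) i)
    ; adj-sym    = λ {v} {w} (v≢w , p) → v≢w ∘ sym , λ i →
        subst (lookup m i ℕ.≤_) (ℕₚ.+-comm (lookup (coords v) i) (lookup (coords w) i)) (p i)
    ; adj-irrefl = λ v≡w (v≢w , _) → v≢w v≡w
    }
  }

{-# OPTIONS --safe #-}

-- The covering graph of a one-entry vector (m) is the threshold graph of the
-- weights v with threshold m.  It is also an interval graph: the vertices with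
-- 2v ≥ m form a clique and the others an independent set, so give v the interval
-- [m − v, m] in the first case and the point {v} in the second.  Hence both
-- parameters are at most 1, and they are 0 exactly when the graph is complete.

module Submission where

open import Defs
open import Data.Nat.Base using (ℕ; _≤_)
open import Data.Product.Base using (_×_)
open import Data.Vec.Base using ([]; _∷_)

open import Data.Empty using (⊥-elim)
open import Data.Fin.Base using (zero; suc)
open import Data.Integer.Base as ℤ using (+_)
import Data.Integer.Properties as ℤₚ
open import Data.List.Membership.Propositional using (_∈_)
open import Data.List.Relation.Unary.Any using (here; there)
open import Data.Nat.Base using (zero; suc; _+_; _∸_; _⊔_; z≤n; s≤s)
open import Data.Nat.Properties as ℕₚ using (_≤?_)
open import Data.Product.Base using (_,_; proj₁; proj₂)
open import Data.Rational.Base as ℚ using (ℚ; 0ℚ; ½)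
open import Data.Rational.Literals using (fromℤ)
import Data.Rational.Properties as ℚₚ
open import Data.Sum.Base using (inj₁; inj₂)
open import Data.Vec.Base using (head)
open import Data.Vec.Relation.Binary.Pointwise.Inductive as Pointwise using ()
open import Function.Base using (_∘_)
open import Function.Bundles using (_⇔_; mk⇔; Equivalence)
open import Function.Construct.Composition using (_⇔-∘_)
open import Function.Construct.Symmetry using (⇔-sym)
open import Relation.Binary.PropositionalEquality
  using (_≡_; _≢_; refl; sym; trans; cong; cong₂; subst)
open import Relation.Nullary using (¬_; Dec; yes; no; contradiction)

open Equivalence using (to; from)

const : ℚ → ℝ
seq    (const q) _ = q
cauchy (const q) ε 0<ε = 0 , λ _ _ _ _ →
  subst (λ z → ℚ.∣ z ∣ ℚ.< ε) (sym (ℚₚ.+-inverseʳ q)) 0<ε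

≤-+-pos : ∀ p {ε} → 0ℚ ℚ.< ε → p ℚ.≤ p ℚ.+ ε
≤-+-pos p {ε} 0<ε = subst (ℚ._≤ p ℚ.+ ε) (ℚₚ.+-identityʳ p)
  (ℚₚ.+-monoʳ-≤ p (ℚₚ.<⇒≤ 0<ε))

-- If q < p, density gives r with q < r < p, and ε = r - q then forces p ≤ r.
≤-+-ε⇒≤ : ∀ {p q} → (∀ ε → 0ℚ ℚ.< ε → p ℚ.≤ q ℚ.+ ε) → p ℚ.≤ q
≤-+-ε⇒≤ {p} {q} p≤q+ε = ℚₚ.≮⇒≥ λ q<p →
  let r , q<r , r<p = ℚₚ.<-dense q<p
      0<r-q   = subst (ℚ._< r ℚ.- q) (ℚₚ.+-inverseʳ q) (ℚₚ.+-monoˡ-< (ℚ.- q) q<r)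
      q+r-q≡r = trans (cong (q ℚ.+_) (ℚₚ.+-comm r (ℚ.- q)))
        (trans (sym (ℚₚ.+-assoc q (ℚ.- q) r))
        (trans (cong (ℚ._+ r) (ℚₚ.+-inverseʳ q)) (ℚₚ.+-identityˡ r)))
  in ℚₚ.<-irrefl refl
    (ℚₚ.<-≤-trans r<p (subst (p ℚ.≤_) q+r-q≡r (p≤q+ε (r ℚ.- q) 0<r-q)))

-- A common point of two intervals may be any Cauchy sequence, so comparing endpoints through it
-- takes transitivity on all of `ℝ`. Each hypothesis is used with ε/2.
≤ʳ-trans : ∀ {x y z} → x ≤ʳ y → y ≤ʳ z → x ≤ʳ z
≤ʳ-trans {x} {y} {z} x≤y y≤z ε 0<ε =
  let N , p = x≤y δ 0<δ
      M , q = y≤z δ 0<δ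
  in N ⊔ M , λ i ≤i → begin
    seq x i                 ≤⟨ p i (ℕₚ.m⊔n≤o⇒m≤o N M ≤i) ⟩
    seq y i ℚ.+ δ           ≤⟨ ℚₚ.+-monoˡ-≤ δ (q i (ℕₚ.m⊔n≤o⇒n≤o N M ≤i)) ⟩
    seq z i ℚ.+ δ ℚ.+ δ     ≡⟨ ℚₚ.+-assoc (seq z i) δ δ ⟩
    seq z i ℚ.+ (δ ℚ.+ δ)   ≡⟨ cong (seq z i ℚ.+_) δ+δ≡ε ⟩
    seq z i ℚ.+ ε           ∎
  where
  open ℚₚ.≤-Reasoning
  δ = ½ ℚ.* ε
  0<δ : 0ℚ ℚ.< δ
  0<δ = subst (ℚ._< δ) (ℚₚ.*-zeroʳ ½) (ℚₚ.*-monoʳ-<-pos ½ 0<ε)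
  δ+δ≡ε : δ ℚ.+ δ ≡ ε
  δ+δ≡ε = trans (sym (ℚₚ.*-distribʳ-+ ε ½ ½)) (ℚₚ.*-identityˡ ε)

const-≤⇔ : ∀ p q → const p ≤ʳ const q ⇔ p ℚ.≤ q
const-≤⇔ p q = mk⇔
  -- The sequences are constant, so the single index `N` supplied for ε already gives p ≤ q + ε.
  (λ p≤q → ≤-+-ε⇒≤ λ ε 0<ε → proj₂ (p≤q ε 0<ε) (proj₁ (p≤q ε 0<ε)) ℕₚ.≤-refl)
  (λ p≤q ε 0<ε → 0 , λ _ _ → ℚₚ.≤-trans p≤q (≤-+-pos q 0<ε))

fromℕ : ℕ → ℚ
fromℕ n = fromℤ (+ n)

fromℕ-≤⇔ : ∀ a b → fromℕ a ℚ.≤ fromℕ b ⇔ a ≤ b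
fromℕ-≤⇔ a b = mk⇔
  (λ { (ℚ.*≤* p) → ℤₚ.drop‿+≤+ (ℤₚ.*-cancelʳ-≤-pos (+ a) (+ b) (+ 1) p) })
  (λ a≤b → ℚ.*≤* (ℤₚ.*-monoʳ-≤-nonNeg (+ 1) (ℤ.+≤+ a≤b)))

fromℕ-+ : ∀ a b → fromℕ a ℚ.+ fromℕ b ≡ fromℕ (a + b)
fromℕ-+ a b = trans
  -- The rational sum unfolds to a normalised fraction over 1 whose numerator still carries factors
  -- 1.
  (cong (ℚ._/ 1) (cong₂ ℤ._+_ (ℤₚ.*-identityʳ (+ a)) (ℤₚ.*-identityʳ (+ b))))
  (ℚₚ.↥p/↧p≡p (fromℕ (a + b)))

natʳ : ℕ → ℝ
natʳ = const ∘ fromℕ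

natʳ-≤⇔ : ∀ a b → natʳ a ≤ʳ natʳ b ⇔ a ≤ b
natʳ-≤⇔ a b = fromℕ-≤⇔ a b ⇔-∘ const-≤⇔ (fromℕ a) (fromℕ b)

natʳ-≤+⇔ : ∀ s a b → natʳ s ≤ʳ natʳ a +ʳ natʳ b ⇔ s ≤ a + b
natʳ-≤+⇔ s a b =
  subst (λ q → fromℕ s ℚ.≤ q ⇔ s ≤ a + b) (sym (fromℕ-+ a b)) (fromℕ-≤⇔ s (a + b))
  ⇔-∘ const-≤⇔ (fromℕ s) (fromℕ a ℚ.+ fromℕ b)

natInterval : ∀ {a b} → a ≤ b → ClosedInterval
natInterval {a} {b} a≤b = record
  { left       = natʳ a
  ; right      = natʳ b
  ; left≤right = from (natʳ-≤⇔ a b) a≤b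
  }

natInterval-intersects⇔ : ∀ {a b c d} (a≤b : a ≤ b) (c≤d : c ≤ d) →
  Intersects (natInterval a≤b) (natInterval c≤d) ⇔ (a ≤ d × c ≤ b)
natInterval-intersects⇔ {a} {b} {c} {d} a≤b c≤d = mk⇔
  (λ (x , (a≤x , x≤b) , (c≤x , x≤d)) →
    to (natʳ-≤⇔ a d) (≤ʳ-trans {natʳ a} {x} {natʳ d} a≤x x≤d) ,
    to (natʳ-≤⇔ c b) (≤ʳ-trans {natʳ c} {x} {natʳ b} c≤x x≤b))
  -- The larger left endpoint lies in both intervals.
  (λ (a≤d , c≤b) → natʳ (a ⊔ c) ,
    (from (natʳ-≤⇔ a _) (ℕₚ.m≤m⊔n a c) , from (natʳ-≤⇔ _ b) (ℕₚ.⊔-lub a≤b c≤b)) ,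
    (from (natʳ-≤⇔ c _) (ℕₚ.m≤n⊔m a c) , from (natʳ-≤⇔ _ d) (ℕₚ.⊔-lub a≤d c≤d)))

-- The endpoints are read off the inequality passed to `natInterval`: m ∸ a and m, or a twice. The
-- decision is an argument so that later proofs can match on it.
coverInterval : ∀ m a → Dec (m ≤ a + a) → ClosedInterval
coverInterval m a (yes _) = natInterval (ℕₚ.m∸n≤m m a)
coverInterval m a (no  _) = natInterval (ℕₚ.≤-refl {a})

m≰n+n⇒n≤m : ∀ {m n} → ¬ m ≤ n + n → n ≤ m
m≰n+n⇒n≤m {m} {n} m≰n+n = ℕₚ.≤-trans (ℕₚ.m≤m+n n n) (ℕₚ.≰⇒≥ m≰n+n)

m∸n≤o⇔m≤n+o : ∀ {m n o} → (m ∸ n ≤ o) ⇔ (m ≤ n + o)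
m∸n≤o⇔m≤n+o {m} {n} {o} = mk⇔
  (λ m∸n≤o → ℕₚ.≤-trans (ℕₚ.m≤n+m∸n m n) (ℕₚ.+-monoʳ-≤ n m∸n≤o))
  (ℕₚ.m≤n+o⇒m∸n≤o m n)

-- Two long intervals share m, and doubling the smaller entry already reaches m. A long interval
-- [m ∸ a, m] meets the point b ≤ m exactly when m ∸ a ≤ b. Two points differ by `a ≢ b`, and
-- doubling the larger entry stays below m.
coverInterval-intersects⇔ : ∀ {m a b} → a ≢ b →
  (da : Dec (m ≤ a + a)) (db : Dec (m ≤ b + b)) →
  Intersects (coverInterval m a da) (coverInterval m b db) ⇔ m ≤ a + b
coverInterval-intersects⇔ {m} {a} {b} _ (yes p) (yes q) =
  mk⇔ (λ _ → m≤a+b (ℕₚ.≤-total a b)) (λ _ → ℕₚ.m∸n≤m m a , ℕₚ.m∸n≤m m b)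
  ⇔-∘ natInterval-intersects⇔ (ℕₚ.m∸n≤m m a) (ℕₚ.m∸n≤m m b)
  where
  m≤a+b : _ → m ≤ a + b
  m≤a+b (inj₁ a≤b) = ℕₚ.≤-trans p (ℕₚ.+-monoʳ-≤ a a≤b)
  m≤a+b (inj₂ b≤a) = ℕₚ.≤-trans q (ℕₚ.+-monoˡ-≤ b b≤a)
coverInterval-intersects⇔ {m} {a} {b} _ (yes _) (no q) =
  mk⇔ (λ (m∸a≤b , _) → to m∸n≤o⇔m≤n+o m∸a≤b) (λ m≤a+b → from m∸n≤o⇔m≤n+o m≤a+b , m≰n+n⇒n≤m q)
  ⇔-∘ natInterval-intersects⇔ (ℕₚ.m∸n≤m m a) ℕₚ.≤-refl
coverInterval-intersects⇔ {m} {a} {b} _ (no p) (yes _) =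
  mk⇔ (λ (_ , m∸b≤a) → subst (m ≤_) (ℕₚ.+-comm b a) (to m∸n≤o⇔m≤n+o m∸b≤a))
      (λ m≤a+b → m≰n+n⇒n≤m p , from m∸n≤o⇔m≤n+o (subst (m ≤_) (ℕₚ.+-comm a b) m≤a+b))
  ⇔-∘ natInterval-intersects⇔ ℕₚ.≤-refl (ℕₚ.m∸n≤m m b)
coverInterval-intersects⇔ {m} {a} {b} a≢b (no p) (no q) =
  mk⇔ (λ (a≤b , b≤a) → contradiction (ℕₚ.≤-antisym a≤b b≤a) a≢b)
      (λ m≤a+b → ⊥-elim (m≰a+b (ℕₚ.≤-total a b) m≤a+b))
  ⇔-∘ natInterval-intersects⇔ ℕₚ.≤-refl ℕₚ.≤-refl
  where
  m≰a+b : _ → ¬ m ≤ a + b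
  m≰a+b (inj₁ a≤b) m≤a+b = q (ℕₚ.≤-trans m≤a+b (ℕₚ.+-monoˡ-≤ b a≤b))
  m≰a+b (inj₂ b≤a) m≤a+b = p (ℕₚ.≤-trans m≤a+b (ℕₚ.+-monoʳ-≤ a b≤a))

entry : ∀ {m} → CoverVertex (m ∷ []) → ℕ
entry = head ∘ coords

-- The other fields of a vertex are irrelevant, so equal vectors give equal vertices. This turns
-- `v ≢ w` into distinct entries for the interval model.
entry-injective : ∀ {m} {v w : CoverVertex (m ∷ [])} → entry v ≡ entry w → v ≡ w
entry-injective {v = mkVertex (_ ∷ []) _ _ _} {mkVertex (_ ∷ []) _ _ _} refl = refl

Adj-D₁⇔ : ∀ {m} (v w : CoverVertex (m ∷ [])) →
  Adj (graph (D (m ∷ []))) v w ⇔ (v ≢ w × m ≤ entry v + entry w)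
Adj-D₁⇔ (mkVertex (_ ∷ []) _ _ _) (mkVertex (_ ∷ []) _ _ _) = mk⇔
  (λ (v≢w , p) → v≢w , p zero)
  (λ (v≢w , p) → v≢w , λ { zero → p })

-- The equivalence may depend on the first factor: the interval model is correct only for distinct
-- vertices.
×-⇔ : ∀ {A B C : Set} → (A → B ⇔ C) → (A × B) ⇔ (A × C)
×-⇔ f = mk⇔ (λ (a , b) → a , to (f a) b) (λ (a , c) → a , from (f a) c)

D₁-isThresholdGraph : ∀ m → IsThresholdGraph (graph (D (m ∷ [])))
D₁-isThresholdGraph m = natʳ ∘ entry , natʳ m , λ v w →
  ×-⇔ (λ _ → ⇔-sym (natʳ-≤+⇔ m (entry v) (entry w))) ⇔-∘ Adj-D₁⇔ v w

D₁-isIntervalGraph : ∀ m → IsIntervalGraph (graph (D (m ∷ [])))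
D₁-isIntervalGraph m = (λ v → coverInterval m (entry v) (dec v)) , λ v w →
  ×-⇔ (λ v≢w → ⇔-sym (coverInterval-intersects⇔ (v≢w ∘ entry-injective) (dec v) (dec w)))
  ⇔-∘ Adj-D₁⇔ v w
  where
  dec : (v : CoverVertex (m ∷ [])) → Dec (m ≤ entry v + entry v)
  dec v = m ≤? entry v + entry v

IsComplete : FiniteSimpleGraph → Set
IsComplete G = ∀ v w → v ≢ w → Adj (graph G) v w

module _ (P : ∀ {V} → SimpleGraph V → Set) where

  complete⇒dimension-0 : ∀ G → IsComplete G → IsMinimum (IsIntersectionOf P G) 0
  complete⇒dimension-0 G complete =
    ((λ ()) , (λ ()) , λ v w v≢w → mk⇔ (λ _ ()) (λ _ → complete v w v≢w)) , λ _ _ → z≤n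

  incomplete⇒dimension-1 : ∀ G → P (graph G) → ¬ IsComplete G →
    IsMinimum (IsIntersectionOf P G) 1
  incomplete⇒dimension-1 G PG incomplete =
    ( (λ _ → graph G)
    , (λ _ → PG)
    , λ _ _ _ → mk⇔ (λ e _ → e) (λ e → e zero)
    ) , 1≤
    where
    1≤ : ∀ k → IsIntersectionOf P G k → 1 ≤ k
    -- An intersection of no graphs has all pairs as edges, which would make G complete.
    1≤ zero    (_ , _ , h) = contradiction (λ v w v≢w → from (h v w v≢w) λ ()) incomplete
    1≤ (suc _) _           = s≤s z≤n

-- For a concrete vector the vertex list evaluates, so completeness becomes a finite case analysis
-- on membership.
enumerated⇒complete : ∀ G →
  (∀ {v w} → v ∈ FiniteSimpleGraph.vertices G → w ∈ FiniteSimpleGraph.vertices G →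
    v ≢ w → Adj (graph G) v w) →
  IsComplete G
enumerated⇒complete G h v w =
  h (FiniteSimpleGraph.enumerates G v) (FiniteSimpleGraph.enumerates G w)

D11-complete : IsComplete (D (1 ∷ 1 ∷ []))
D11-complete = enumerated⇒complete (D (1 ∷ 1 ∷ [])) λ where
  -- The list consists of (0,1) and (1,0), whose sum is 1 in both coordinates.
  (here refl)         (here refl)         v≢w → contradiction refl v≢w
  (here refl)         (there (here refl)) v≢w → v≢w , λ { zero → s≤s z≤n ; (suc zero) → s≤s z≤n }
  (there (here refl)) (here refl)         v≢w → v≢w , λ { zero → s≤s z≤n ; (suc zero) → s≤s z≤n }
  (there (here refl)) (there (here refl)) v≢w → contradiction refl v≢w

-- There is no vertex for m = 1 and one for m = 2; for m = 3 the two vertices 1 and 2 sum to exactly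
-- 3.
D₁-complete : ∀ m → 1 ≤ m → m ≤ 3 → IsComplete (D (m ∷ []))
D₁-complete 1 _ _ = enumerated⇒complete (D (1 ∷ [])) λ ()
D₁-complete 2 _ _ = enumerated⇒complete (D (2 ∷ [])) λ where
  (here refl) (here refl) v≢w → contradiction refl v≢w
D₁-complete 3 _ _ = enumerated⇒complete (D (3 ∷ [])) λ where
  (here refl)         (here refl)         v≢w → contradiction refl v≢w
  (here refl)         (there (here refl)) v≢w → v≢w , λ { zero → s≤s (s≤s (s≤s z≤n)) }
  (there (here refl)) (here refl)         v≢w → v≢w , λ { zero → s≤s (s≤s (s≤s z≤n)) }
  (there (here refl)) (there (here refl)) v≢w → contradiction refl v≢w
D₁-complete (suc (suc (suc (suc _)))) _ (s≤s (s≤s (s≤s ())))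

D₁-incomplete : ∀ m → 4 ≤ m → ¬ IsComplete (D (m ∷ []))
D₁-incomplete m 4≤m complete =
  -- Adjacency of the vertices 1 and 2 would give m ≤ 3.
  ℕₚ.<⇒≱ 4≤m (proj₂ (complete one two λ ()) zero)
  where
  one two : CoverVertex (m ∷ [])
  one = mkVertex (1 ∷ []) (ℕₚ.≤-trans (s≤s z≤n) 4≤m Pointwise.∷ Pointwise.[]) (λ ())
    (λ { refl → contradiction 4≤m λ { (s≤s ()) } })
  two = mkVertex (2 ∷ []) (ℕₚ.≤-trans (s≤s (s≤s z≤n)) 4≤m Pointwise.∷ Pointwise.[]) (λ ())
    (λ { refl → contradiction 4≤m λ { (s≤s (s≤s ())) } })

lemma40 : (Boxicity (D (1 ∷ 1 ∷ [])) 0 × ThresholdDimension (D (1 ∷ 1 ∷ [])) 0) ×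
    (∀ (m : ℕ) → 1 ≤ m →
    (m ≤ 3 → Boxicity (D (m ∷ [])) 0 × ThresholdDimension (D (m ∷ [])) 0) ×
    (4 ≤ m → Boxicity (D (m ∷ [])) 1 × ThresholdDimension (D (m ∷ [])) 1))
lemma40 =
  ( complete⇒dimension-0 IsIntervalGraph  (D (1 ∷ 1 ∷ [])) D11-complete
  , complete⇒dimension-0 IsThresholdGraph (D (1 ∷ 1 ∷ [])) D11-complete ) ,
  λ m 1≤m →
    (λ m≤3 →
      complete⇒dimension-0 IsIntervalGraph  (D (m ∷ [])) (D₁-complete m 1≤m m≤3) ,
      complete⇒dimension-0 IsThresholdGraph (D (m ∷ [])) (D₁-complete m 1≤m m≤3)) ,
    (λ 4≤m →
      incomplete⇒dimension-1 IsIntervalGraph  (D (m ∷ [])) (D₁-isIntervalGraph m) (D₁-incomplete m 4≤m) ,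
      incomplete⇒dimension-1 IsThresholdGraph (D (m ∷ [])) (D₁-isThresholdGraph m) (D₁-incomplete m 4≤m))
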